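{- For every integer $i\geq 8$ there exist an integer $j<i$ and directed graphs $G$ and $H$ such that $G$ has diameter $i$, $H$ has diameter $j$, and the directed edge polytopes of $G$ and $H$ have the same volume.
   Context: For a directed graph $D=(V,A)$, its directed edge polytope is the convex hull in $\mathbb{R}^V$ of the vectors $e_v-e_w$ for all arcs $(w,v)\in A$, where $(e_u)_{u\in V}$ is the standard basis. The distance from $u$ to $v$ is the number of arcs of a shortest directed path from $u$ to $v$ ($\infty$ if none exists), and the diameter is the maximum distance over all ordered pairs of vertices. -}

module Defs where

open import Data.Fin using (Fin; _≟_)
open import Data.Integer using (ℤ; +_)
open import Data.List using (List; length)
open import Data.List.Membership.Propositional using (_∈_)
open import Data.List.Relation.Unary.Unique.Propositional using (Unique)
open import Data.Nat as ℕ using (ℕ; zero; suc; _^_; _!; NonZero)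
open import Data.Nat.Properties using (m^n≢0)
open import Data.Product using (Σ-syntax; ∃-syntax; _×_)
open import Data.Rational using (ℚ; 0ℚ; 1ℚ; _/_; _*_; _-_; _≤_; _<_; ∣_∣)
open import Data.Rational.Properties using (+-0-commutativeMonoid)
open import Data.Vec using (Vec; lookup)
open import Data.Vec.Functional using (Vector)
open import Algebra.Properties.CommutativeMonoid.Sum +-0-commutativeMonoid using (sum)
open import Data.Bool using (if_then_else_)
open import Function.Bundles using (_⇔_)
open import Level using (0ℓ)
open import Relation.Binary using (Rel; Decidable; Irreflexive)
open import Relation.Binary.PropositionalEquality using (_≡_; _≗_)
open import Relation.Nullary using (does)
open import Relation.Unary using (Pred)

------------------------------------------------------------------------
-- Directed graphs

-- Finite, without loops or parallel arcs; opposite arcs are allowed.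
record Digraph : Set₁ where
  field
    order    : ℕ
    Arc      : Rel (Fin order) 0ℓ
    arc?     : Decidable Arc
    loopless : Irreflexive _≡_ Arc

module _ (G : Digraph) where
  open Digraph G

  -- Walk l u v : a directed walk with l arcs from u to v.  Vertices may
  -- repeat, but a shortest walk never repeats one, so distances may be
  -- computed with walks.
  data Walk : ℕ → Fin order → Fin order → Set where
    []  : ∀ {u} → Walk 0 u u
    _∷_ : ∀ {l u v w} → Arc u v → Walk l v w → Walk (suc l) u w

  IsDistance : Fin order → Fin order → ℕ → Set
  IsDistance u v d = Walk d u v × (∀ l → Walk l u v → d ℕ.≤ l)

  -- A diameter in ℕ (as opposed to ∞) makes every distance finite.
  HasDiameter : ℕ → Set
  HasDiameter m =
    (∀ u v → ∃[ d ] IsDistance u v d × d ℕ.≤ m) ×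
    (∃[ u ] ∃[ v ] IsDistance u v m)

------------------------------------------------------------------------
-- Convexity.  All polytopes considered are convex hulls of lattice points,
-- so they are represented by their rational points.

combination : ∀ {m n} → Vector ℚ m → (Fin m → Vector ℚ n) → Vector ℚ n
combination c p v = sum (λ k → c k * p k v)

Conv : ∀ {n} → Pred (Vector ℚ n) 0ℓ → Pred (Vector ℚ n) 0ℓ
Conv {n} S x =
  ∃[ m ] Σ[ p ∈ (Fin m → Vector ℚ n) ] Σ[ c ∈ Vector ℚ m ]
    (∀ k → S (p k)) × (∀ k → 0ℚ ≤ c k) × sum c ≡ 1ℚ × x ≗ combination c p

AffinelyIndependent : ∀ {m n} → (Fin m → Vector ℚ n) → Set
AffinelyIndependent {m} p =
  (c : Vector ℚ m) → sum c ≡ 0ℚ → combination c p ≗ (λ _ → 0ℚ) → c ≗ (λ _ → 0ℚ)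

-- The affine hull of S has an affine basis of d + 1 points of S.
HasDimension : ∀ {n} → Pred (Vector ℚ n) 0ℓ → ℕ → Set
HasDimension {n} S d =
  Σ[ p ∈ (Fin (suc d) → Vector ℚ n) ]
    (∀ k → S (p k)) ×
    AffinelyIndependent p ×
    (∀ x → S x → Σ[ c ∈ Vector ℚ (suc d) ] sum c ≡ 1ℚ × x ≗ combination c p)

------------------------------------------------------------------------
-- Volume

-- Dilate k S = { k · y | y ∈ S }
Dilate : ∀ {n} → ℕ → Pred (Vector ℚ n) 0ℓ → Pred (Vector ℚ n) 0ℓ
Dilate {n} k S x = Σ[ y ∈ Vector ℚ n ] S y × x ≗ (λ v → (+ k / 1) * y v)

-- The set S ∩ ℤⁿ is finite with exactly N elements.
HasLatticeCount : ∀ {n} → Pred (Vector ℚ n) 0ℓ → ℕ → Set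
HasLatticeCount {n} S N =
  Σ[ xs ∈ List (Vec ℤ n) ]
    Unique xs ×
    (∀ x → x ∈ xs ⇔ S (λ v → lookup x v / 1)) ×
    length xs ≡ N

-- a k ⟶ q as k → ∞, for a sequence indexed by the positive integers.
HasLimit : ((k : ℕ) .{{_ : NonZero k}} → ℚ) → ℚ → Set
HasLimit a q =
  ∀ ε → 0ℚ < ε → ∃[ K ] (∀ k .{{_ : NonZero k}} → K ℕ.≤ k → ∣ a k - q ∣ < ε)

-- Normalised volume of a lattice polytope P of dimension d: d! times the
-- d-dimensional volume of P inside its affine hull, the unit of volume being
-- a fundamental cell of the lattice aff(P) ∩ ℤⁿ.  (The n-dimensional volume
-- is 0 as soon as d < n.)  The volume is the limit of the Riemann sums
-- #(P ∩ (1/k)ℤⁿ) / kᵈ = #(kP ∩ ℤⁿ) / kᵈ.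
HasVolume : ∀ {n} → Pred (Vector ℚ n) 0ℓ → ℚ → Set
HasVolume P q =
  ∃[ d ] HasDimension P d ×
  (Σ[ N ∈ (ℕ → ℕ) ]
    (∀ k .{{_ : NonZero k}} → HasLatticeCount (Dilate k P) (N k)) ×
    HasLimit (λ k → _/_ (+ (d ! ℕ.* N k)) (k ^ d) {{m^n≢0 k d}}) q)

------------------------------------------------------------------------
-- Directed edge polytopes

e : ∀ {n} → Fin n → Vector ℚ n
e u v = if does (u ≟ v) then 1ℚ else 0ℚ

EdgePolytope : (G : Digraph) → Pred (Vector ℚ (Digraph.order G)) 0ℓ
EdgePolytope G = Conv λ x → ∃[ w ] ∃[ v ] Arc w v × x ≗ (λ t → e v t - e w t)
  where open Digraph G

{-# OPTIONS --safe #-}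

-- Orient the edges of a tree on i + 1 vertices in both directions.  The arc
-- vectors are then ± b₁, …, ± bᵢ, where b₁, …, bᵢ is a lattice basis of the
-- vectors with coordinate sum 0, so the directed edge polytope is a unimodular
-- copy of the i-dimensional cross-polytope and has normalised volume 2ⁱ,
-- whatever the tree.  Take G to be the path, of diameter i, and H the star, of
-- diameter 2.
--
-- The lattice points of the k-fold cross-polytope satisfy Delannoy's
-- recurrence, which yields 2ᵈ (k − d)ᵈ ≤ d! N(k) ≤ 2ᵈ (k + d)ᵈ and so the limit.

module Submission where

open import Defs
open import Algebra.Bundles using (CommutativeRing)
open import Data.Bool using (true; false; if_then_else_)
open import Data.Fin using (Fin; zero; suc; _≟_; toℕ; inject₁; fromℕ)
open import Data.Fin.Properties using (any?; toℕ-inject₁; toℕ-injective; toℕ-fromℕ; toℕ≤pred[n])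
open import Data.Integer as ℤ using (ℤ; +_; +[1+_]; -[1+_]; 0ℤ; 1ℤ)
import Data.Integer.Properties as ℤₚ
open import Data.List using (List; []; _∷_; _++_; map; length)
open import Data.List.Properties using (length-++; length-map)
open import Data.List.Membership.Propositional using (_∈_)
open import Data.List.Membership.Propositional.Properties
  using (∈-map⁺; ∈-map⁻; ∈-++⁺ˡ; ∈-++⁺ʳ; ∈-++⁻)
open import Data.List.Relation.Binary.Disjoint.Propositional using (Disjoint)
open import Data.List.Relation.Unary.All using ([])
open import Data.List.Relation.Unary.AllPairs using ([]; _∷_)
open import Data.List.Relation.Unary.Any using (here)
open import Data.List.Relation.Unary.Unique.Propositional using (Unique)
open import Data.List.Relation.Unary.Unique.Propositional.Properties using (map⁺; ++⁺)
open import Data.Nat as ℕ using (ℕ; zero; suc; _^_; _!; NonZero; z≤n; s≤s; _∸_)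
import Data.Nat.Properties as ℕₚ
open import Data.Nat.Tactic.RingSolver using (solve-∀)
open import Data.Product using (Σ-syntax; ∃-syntax; _×_; _,_; proj₁; proj₂)
open import Data.Rational as ℚ using (ℚ; mkℚ; 0ℚ; 1ℚ; ½; toℚᵘ)
import Data.Rational.Properties as ℚₚ
open import Data.Rational.Solver using (module +-*-Solver)
open import Data.Rational.Unnormalised as ℚᵘ using (mkℚᵘ; *≡*; *≤*; *<*)
import Data.Rational.Unnormalised.Properties as ℚᵘₚ
open import Data.Sum using (_⊎_; inj₁; inj₂)
open import Data.Vec using (Vec; []; _∷_; lookup; tabulate)
open import Data.Vec.Functional using (Vector)
open import Data.Vec.Properties using (lookup∘tabulate; tabulate∘lookup; tabulate-cong)
open import Algebra.Properties.CommutativeMonoid.Sum ℚₚ.+-0-commutativeMonoid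
  using (sum; sum-cong-≗; sum-replicate-zero; ∑-distrib-+; ∑-comm)
import Algebra.Properties.CommutativeMonoid.Sum ℤₚ.+-0-commutativeMonoid as ℤ-Sum
open import Algebra.Properties.Group ℚₚ.+-0-group using (⁻¹-involutive)
open import Algebra.Properties.Ring (CommutativeRing.ring ℚₚ.+-*-commutativeRing) using (-1*x≈-x)
open import Algebra.Properties.Semiring.Sum (CommutativeRing.semiring ℚₚ.+-*-commutativeRing)
  using (*-distribˡ-sum; *-distribʳ-sum)
open import Function using (_∘_; mk⇔)
open import Relation.Nullary using (yes; no; does; contradiction)
open import Relation.Nullary.Decidable using (_×-dec_; _⊎-dec_; dec-true)
open import Relation.Binary.PropositionalEquality

-- Lattice points of the cross-polytope

-- Write f d k for the count N(k) in dimension d multiplied by d!. The recurrence becomes f (d+1)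
-- (k+1) - f (d+1) k = (d+1) (f d (k+1) + f d k), a discrete form of the differential equation of
-- (2k)^(d+1), whose derivative is 2 (d+1) (2k)^d. Mean value estimates for powers therefore give
-- both bounds by double induction on d and k, without a closed formula for the count. All of this
-- stays in the natural numbers with denominators cleared; only the final error estimate C / k is
-- carried over to the rationals.
--
-- On the polytope side the delicate point is that a dilate contains no lattice points besides the
-- integral combinations of the arc vectors. Integral functionals dual to one arc vector per edge
-- settle this: they read off the coefficients of a point, so a lattice point has integral
-- coefficients.

module LatticeBall where

  open import Data.Nat
  open import Data.Nat.Properties

  ℓ¹ : ∀ {d} → Vec ℤ d → ℕ
  ℓ¹ []      = 0
  ℓ¹ (x ∷ y) = ℤ.∣ x ∣ + ℓ¹ y

  -- Given lists B r of the vectors of norm at most r, the vectors x ∷ y with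
  -- h < ∣x∣ and ∣x∣ + ℓ¹ y ≤ h + r.
  shell : ∀ {d} → (ℕ → List (Vec ℤ d)) → ℕ → ℕ → List (Vec ℤ (suc d))
  shell B h zero    = []
  shell B h (suc r) =
    map (+[1+ h ] ∷_) (B r) ++ map (-[1+ h ] ∷_) (B r) ++ shell B (suc h) r

  ball : (d k : ℕ) → List (Vec ℤ d)
  ball zero    k = [] ∷ []
  ball (suc d) k = map (0ℤ ∷_) (ball d k) ++ shell (ball d) 0 k

  module _ {d : ℕ} (B : ℕ → List (Vec ℤ d)) where

    module _ (B⁻ : ∀ {r y} → y ∈ B r → ℓ¹ y ≤ r) where

      shell⁻ : ∀ h r {x y} → x ∷ y ∈ shell B h r → h < ℤ.∣ x ∣ × ℤ.∣ x ∣ + ℓ¹ y ≤ h + r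
      shell⁻ h (suc r) {x} {y} m rewrite +-suc h r with ∈-++⁻ (map (+[1+ h ] ∷_) (B r)) m
      ... | inj₁ m₁ with y , y∈ , refl ← ∈-map⁻ _ m₁ = ≤-refl , s≤s (+-monoʳ-≤ h (B⁻ y∈))
      ... | inj₂ m₂ with ∈-++⁻ (map (-[1+ h ] ∷_) (B r)) m₂
      ... | inj₁ m₃ with y , y∈ , refl ← ∈-map⁻ _ m₃ = ≤-refl , s≤s (+-monoʳ-≤ h (B⁻ y∈))
      ... | inj₂ m₄ with lt , le ← shell⁻ (suc h) r m₄ = <-trans (n<1+n h) lt , le

      -- The three blocks are told apart by their heads: `+[1+ h ]`, `-[1+ h ]`, and heads of
      -- absolute value greater than `suc h`.
      shell-unique : (∀ r → Unique (B r)) → ∀ h r → Unique (shell B h r)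
      shell-unique u h zero    = []
      shell-unique u h (suc r) =
        ++⁺ (map⁺ (λ { refl → refl }) (u r))
            (++⁺ (map⁺ (λ { refl → refl }) (u r)) (shell-unique u (suc h) r) disjoint₂)
            disjoint₁
        where
        disjoint₂ : Disjoint (map (-[1+ h ] ∷_) (B r)) (shell B (suc h) r)
        disjoint₂ (m₁ , m₂) with y , y∈ , refl ← ∈-map⁻ _ m₁ =
          <-irrefl refl (proj₁ (shell⁻ (suc h) r m₂))

        disjoint₁ : Disjoint (map (+[1+ h ] ∷_) (B r)) (map (-[1+ h ] ∷_) (B r) ++ shell B (suc h) r)
        disjoint₁ (m₁ , m₂) with y , y∈ , refl ← ∈-map⁻ _ m₁ | ∈-++⁻ (map (-[1+ h ] ∷_) (B r)) m₂
        ... | inj₁ m₃ with _ , _ , () ← ∈-map⁻ _ m₃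
        ... | inj₂ m₃ = <-irrefl refl (proj₁ (shell⁻ (suc h) r m₃))

    shell⁺ : (∀ {r y} → ℓ¹ y ≤ r → y ∈ B r) →
             ∀ h r x y → h < ℤ.∣ x ∣ → ℤ.∣ x ∣ + ℓ¹ y ≤ h + r → x ∷ y ∈ shell B h r
    shell⁺ B⁺ h zero x y lt le =
      contradiction (<-≤-trans lt (≤-trans (m≤m+n ℤ.∣ x ∣ (ℓ¹ y))
        (≤-trans le (≤-reflexive (+-identityʳ h))))) (<-irrefl refl)
    shell⁺ B⁺ h (suc r) x y lt le rewrite +-suc h r with m≤n⇒m<n∨m≡n lt
    ... | inj₁ lt′ = ∈-++⁺ʳ (map (+[1+ h ] ∷_) (B r))
      (∈-++⁺ʳ (map (-[1+ h ] ∷_) (B r)) (shell⁺ B⁺ (suc h) r x y lt′ le))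
    shell⁺ B⁺ h (suc r) +[1+ h ] y lt le | inj₂ refl = ∈-++⁺ˡ (∈-map⁺ _ (B⁺ (+-cancelˡ-≤ h _ _ (s≤s⁻¹ le))))
    shell⁺ B⁺ h (suc r) -[1+ h ] y lt le | inj₂ refl =
      ∈-++⁺ʳ (map (+[1+ h ] ∷_) (B r)) (∈-++⁺ˡ (∈-map⁺ _ (B⁺ (+-cancelˡ-≤ h _ _ (s≤s⁻¹ le)))))

    length-shell : ∀ h r → length (shell B h (suc r)) ≡ length (B r) + length (B r) + length (shell B (suc h) r)
    length-shell h r = begin
      length (P ++ N ++ S)                  ≡⟨ length-++ P ⟩
      length P + length (N ++ S)            ≡⟨ cong (λ l → length P + l) (length-++ N) ⟩
      length P + (length N + length S)      ≡⟨ +-assoc (length P) (length N) (length S) ⟨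
      length P + length N + length S
        ≡⟨ cong₂ (λ a b → a + b + length S) (length-map _ (B r)) (length-map _ (B r)) ⟩
      length (B r) + length (B r) + length S ∎
      where
      open ≡-Reasoning
      P = map (+[1+ h ] ∷_) (B r)
      N = map (-[1+ h ] ∷_) (B r)
      S = shell B (suc h) r

    -- The offset `h` changes the heads but not how many vectors there are. So the part of
    -- `shell B 0 (suc k)` beyond the heads ±1 is as large as `shell B 0 k`.
    length-shell-shift : ∀ h h′ r → length (shell B h r) ≡ length (shell B h′ r)
    length-shell-shift h h′ zero    = refl
    length-shell-shift h h′ (suc r) = trans (length-shell h r)
      (trans (cong (λ l → length (B r) + length (B r) + l) (length-shell-shift (suc h) (suc h′) r)) (sym (length-shell h′ r)))

  ball⁻ : ∀ d {k y} → y ∈ ball d k → ℓ¹ y ≤ k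
  ball⁻ zero    {y = []} _ = z≤n
  ball⁻ (suc d) {k} {x ∷ y} m with ∈-++⁻ (map (0ℤ ∷_) (ball d k)) m
  ... | inj₁ m₁ with y , y∈ , refl ← ∈-map⁻ _ m₁ = ball⁻ d y∈
  ... | inj₂ m₂ = proj₂ (shell⁻ (ball d) (ball⁻ d) 0 k m₂)

  ball⁺ : ∀ d {k y} → ℓ¹ y ≤ k → y ∈ ball d k
  ball⁺ zero    {y = []} _ = here refl
  ball⁺ (suc d) {y = ℤ.+ zero ∷ y} le = ∈-++⁺ˡ (∈-map⁺ _ (ball⁺ d le))
  ball⁺ (suc d) {k} {x@(+[1+ _ ]) ∷ y} le =
    ∈-++⁺ʳ (map (0ℤ ∷_) (ball d k)) (shell⁺ (ball d) (ball⁺ d) 0 k x y (s≤s z≤n) le)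
  ball⁺ (suc d) {k} {x@(-[1+ _ ]) ∷ y} le =
    ∈-++⁺ʳ (map (0ℤ ∷_) (ball d k)) (shell⁺ (ball d) (ball⁺ d) 0 k x y (s≤s z≤n) le)

  ball-unique : ∀ d k → Unique (ball d k)
  ball-unique zero    k = [] ∷ []
  ball-unique (suc d) k =
    ++⁺ (map⁺ (λ { refl → refl }) (ball-unique d k))
        (shell-unique (ball d) (ball⁻ d) (ball-unique d) 0 k)
        disjoint
    where
    disjoint : Disjoint (map (0ℤ ∷_) (ball d k)) (shell (ball d) 0 k)
    disjoint (m₁ , m₂) with y , y∈ , refl ← ∈-map⁻ _ m₁
      with () ← proj₁ (shell⁻ (ball d) (ball⁻ d) 0 k m₂)

  -- Cardinality of the ball and its recurrence

  ∣ball∣ : ℕ → ℕ → ℕ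
  ∣ball∣ d k = length (ball d k)

  ∣ball∣-suc : ∀ d k → ∣ball∣ (suc d) k ≡ ∣ball∣ d k + length (shell (ball d) 0 k)
  ∣ball∣-suc d k = trans (length-++ (map (0ℤ ∷_) (ball d k)))
    (cong (_+ length (shell (ball d) 0 k)) (length-map _ (ball d k)))

  -- The slice with head 0 contributes `∣ball∣ d (suc k)` and the slices with heads ±1 contribute
  -- `∣ball∣ d k` each. Moving the other heads one step towards 0 makes them the nonzero heads for
  -- radius `k`; one of the two copies of `∣ball∣ d k` supplies the missing slice at 0.
  ∣ball∣-rec : ∀ d k → ∣ball∣ (suc d) (suc k) ≡ ∣ball∣ (suc d) k + (∣ball∣ d (suc k) + ∣ball∣ d k)
  ∣ball∣-rec d k = begin
    ∣ball∣ (suc d) (suc k)  ≡⟨ ∣ball∣-suc d (suc k) ⟩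
    b′ + length (shell (ball d) 0 (suc k))
      ≡⟨ cong (λ l → b′ + l) (trans (length-shell (ball d) 0 k)
           (cong (λ l → b + b + l) (length-shell-shift (ball d) 1 0 k))) ⟩
    b′ + (b + b + s)        ≡⟨ rearrange b b′ s ⟩
    b + s + (b′ + b)        ≡⟨ cong (_+ (b′ + b)) (∣ball∣-suc d k) ⟨
    ∣ball∣ (suc d) k + (b′ + b) ∎
    where
    open ≡-Reasoning
    b = ∣ball∣ d k
    b′ = ∣ball∣ d (suc k)
    s = length (shell (ball d) 0 k)
    rearrange : ∀ b b′ s → b′ + (b + b + s) ≡ b + s + (b′ + b)
    rearrange = solve-∀

  -- Two-sided bounds for the count and their relative error

  [1+m]^n≥ : ∀ m n → m ^ suc n + suc n * m ^ n ≤ suc m ^ suc n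
  [1+m]^n≥ m zero    = ≤-reflexive (eq m)
    where
    eq : ∀ m → m * 1 + (1 + 0) * 1 ≡ suc m * 1
    eq = solve-∀
  [1+m]^n≥ m (suc n) = begin
    m * (m * p) + (2 + n) * (m * p)            ≤⟨ m≤m+n _ (suc n * p) ⟩
    m * (m * p) + (2 + n) * (m * p) + suc n * p ≡⟨ eq m n p ⟩
    suc m * (m * p + suc n * p)                ≤⟨ *-monoʳ-≤ (suc m) ([1+m]^n≥ m n) ⟩
    suc m * suc m ^ suc n                      ∎
    where
    open ≤-Reasoning
    p = m ^ n
    eq : ∀ m n p → m * (m * p) + (2 + n) * (m * p) + suc n * p ≡ suc m * (m * p + suc n * p)
    eq = solve-∀

  -- With `[1+m]^n≥`, this is the mean value theorem for t^(n+1) on [m, m+1]: the derivative lies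
  -- between its values at the two ends.
  [1+m]^n≤ : ∀ m n → suc m ^ suc n ≤ m ^ suc n + suc n * suc m ^ n
  [1+m]^n≤ m zero    = ≤-reflexive (eq m)
    where
    eq : ∀ m → suc m * 1 ≡ m * 1 + (1 + 0) * 1
    eq = solve-∀
  [1+m]^n≤ m (suc n) = begin
    suc m * suc m ^ suc n                            ≤⟨ *-monoʳ-≤ (suc m) ([1+m]^n≤ m n) ⟩
    suc m * (m ^ suc n + suc n * q)                  ≡⟨ eq m n (m ^ suc n) q ⟩
    m * m ^ suc n + (m ^ suc n + suc n * (suc m * q))
      ≤⟨ +-monoʳ-≤ (m * m ^ suc n) (+-monoˡ-≤ _ (^-monoˡ-≤ (suc n) (n≤1+n m))) ⟩
    m * m ^ suc n + (suc m * q + suc n * (suc m * q)) ≡⟨⟩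
    m * m ^ suc n + (2 + n) * (suc m * q)            ∎
    where
    open ≤-Reasoning
    q = suc m ^ n
    eq : ∀ m n a q → suc m * (a + suc n * q) ≡ m * a + (a + suc n * (suc m * q))
    eq = solve-∀

  d!∣ball∣-rec : ∀ d k → suc d ! * ∣ball∣ (suc d) (suc k) ≡
    suc d ! * ∣ball∣ (suc d) k + suc d * (d ! * ∣ball∣ d (suc k) + d ! * ∣ball∣ d k)
  d!∣ball∣-rec d k = trans (cong (suc d ! *_) (∣ball∣-rec d k))
    (eq (d !) (suc d) (∣ball∣ (suc d) k) (∣ball∣ d (suc k)) (∣ball∣ d k))
    where
    eq : ∀ f n a b c → n * f * (a + (b + c)) ≡ n * f * a + n * (f * b + f * c)
    eq = solve-∀

  -- The shift by `d` closes the induction. With m = k + d + 1, the bounds for radius `k` in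
  -- dimension `suc d` and for radius `suc k` in dimension `d` both have base m, and the third term
  -- has the smaller base k + d.
  d!∣ball∣≤ : ∀ d k → d ! * ∣ball∣ d k ≤ 2 ^ d * (k + d) ^ d
  d!∣ball∣≤ zero    k = ≤-refl
  d!∣ball∣≤ (suc d) zero = begin
    suc d * d ! * ∣ball∣ (suc d) 0     ≡⟨ cong (suc d * d ! *_) (trans (∣ball∣-suc d 0) (+-identityʳ _)) ⟩
    suc d * d ! * ∣ball∣ d 0           ≡⟨ *-assoc (suc d) (d !) _ ⟩
    suc d * (d ! * ∣ball∣ d 0)         ≤⟨ *-monoʳ-≤ (suc d) (d!∣ball∣≤ d 0) ⟩
    suc d * (2 ^ d * d ^ d)            ≤⟨ *-monoʳ-≤ (suc d) (*-mono-≤ (m≤n*m (2 ^ d) 2) (^-monoˡ-≤ d (n≤1+n d))) ⟩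
    suc d * (2 ^ suc d * suc d ^ d)    ≡⟨ eq (suc d) (2 ^ suc d) (suc d ^ d) ⟩
    2 ^ suc d * suc d ^ suc d          ∎
    where
    open ≤-Reasoning
    eq : ∀ a b c → a * (b * c) ≡ b * (a * c)
    eq = solve-∀
  d!∣ball∣≤ (suc d) (suc k) = begin
    suc d ! * ∣ball∣ (suc d) (suc k)
      ≡⟨ d!∣ball∣-rec d k ⟩
    suc d ! * ∣ball∣ (suc d) k + suc d * (d ! * ∣ball∣ d (suc k) + d ! * ∣ball∣ d k)
      ≤⟨ +-mono-≤ (d!∣ball∣≤ (suc d) k) (*-monoʳ-≤ (suc d) (+-mono-≤ bound₁ bound₂)) ⟩
    2 ^ suc d * m ^ suc d + suc d * (2 ^ d * m ^ d + 2 ^ d * m ^ d)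
      ≡⟨ eq d (2 ^ d) (m ^ suc d) (m ^ d) ⟩
    2 ^ suc d * (m ^ suc d + suc d * m ^ d)
      ≤⟨ *-monoʳ-≤ (2 ^ suc d) ([1+m]^n≥ m d) ⟩
    2 ^ suc d * suc m ^ suc d ∎
    where
    open ≤-Reasoning
    m = k + suc d
    bound₁ : d ! * ∣ball∣ d (suc k) ≤ 2 ^ d * m ^ d
    bound₁ = subst (λ z → d ! * ∣ball∣ d (suc k) ≤ 2 ^ d * z ^ d) (sym (+-suc k d)) (d!∣ball∣≤ d (suc k))
    bound₂ : d ! * ∣ball∣ d k ≤ 2 ^ d * m ^ d
    bound₂ = ≤-trans (d!∣ball∣≤ d k) (*-monoʳ-≤ (2 ^ d) (^-monoˡ-≤ d (+-monoʳ-≤ k (n≤1+n d))))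
    eq : ∀ d t a b → 2 * t * a + suc d * (t * b + t * b) ≡ 2 * t * (a + suc d * b)
    eq = solve-∀

  -- Stated at radius `k + d` to keep truncated subtraction out of the induction. At radius
  -- `k + suc d` the bound in dimension `d` already has base `suc k`, as the upper estimate
  -- `[1+m]^n≤` demands.
  d!∣ball∣≥ : ∀ d k → 2 ^ d * k ^ d ≤ d ! * ∣ball∣ d (k + d)
  d!∣ball∣≥ zero    k    = ≤-refl
  d!∣ball∣≥ (suc d) zero = ≤-trans (≤-reflexive (*-zeroʳ (2 ^ suc d))) z≤n
  d!∣ball∣≥ (suc d) (suc k) = begin
    2 ^ suc d * suc k ^ suc d
      ≤⟨ *-monoʳ-≤ (2 ^ suc d) ([1+m]^n≤ k d) ⟩
    2 ^ suc d * (k ^ suc d + suc d * suc k ^ d)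
      ≡⟨ eq d (2 ^ d) (k ^ suc d) (suc k ^ d) ⟩
    2 ^ suc d * k ^ suc d + suc d * (2 ^ d * suc k ^ d + 2 ^ d * suc k ^ d)
      ≤⟨ +-mono-≤ (d!∣ball∣≥ (suc d) k) (*-monoʳ-≤ (suc d) (+-mono-≤ bound₁ bound₂)) ⟩
    suc d ! * ∣ball∣ (suc d) m + suc d * (d ! * ∣ball∣ d (suc m) + d ! * ∣ball∣ d m)
      ≡⟨ d!∣ball∣-rec d m ⟨
    suc d ! * ∣ball∣ (suc d) (suc m) ∎
    where
    open ≤-Reasoning
    m = k + suc d
    bound₂ : 2 ^ d * suc k ^ d ≤ d ! * ∣ball∣ d m
    bound₂ = subst (λ z → 2 ^ d * suc k ^ d ≤ d ! * ∣ball∣ d z) (sym (+-suc k d)) (d!∣ball∣≥ d (suc k))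
    bound₁ : 2 ^ d * suc k ^ d ≤ d ! * ∣ball∣ d (suc m)
    bound₁ = ≤-trans (*-monoʳ-≤ (2 ^ d) (^-monoˡ-≤ d (n≤1+n (suc k))))
      (subst (λ z → 2 ^ d * suc (suc k) ^ d ≤ d ! * ∣ball∣ d (suc z)) (sym (+-suc k d)) (d!∣ball∣≥ d (suc (suc k))))
    eq : ∀ d t a b → 2 * t * (a + suc d * b) ≡ 2 * t * a + suc d * (t * b + t * b)
    eq = solve-∀

  -- Divided by k^(n+1), this reads (1 + m/k)^n ≤ 1 + c/k with c = (2m+1)^n. The constant comes from
  -- the induction step: as k and c are at least 1, (1 + m/k)(1 + c/k) ≤ 1 + (c + m + cm)/k ≤ 1 +
  -- (2m+1)c/k.
  k*[k+m]^n≤ : ∀ m n k .{{_ : NonZero k}} → (k + m) ^ n * k ≤ (k + suc (2 * m) ^ n) * k ^ n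
  k*[k+m]^n≤ m zero    k = ≤-trans (≤-reflexive (+-identityʳ k))
    (≤-trans (m≤m+n k 1) (≤-reflexive (sym (*-identityʳ (k + 1)))))
  k*[k+m]^n≤ m (suc n) k = begin
    (k + m) * (k + m) ^ n * k                       ≡⟨ *-assoc (k + m) ((k + m) ^ n) k ⟩
    (k + m) * ((k + m) ^ n * k)                     ≤⟨ *-monoʳ-≤ (k + m) (k*[k+m]^n≤ m n k) ⟩
    (k + m) * ((k + c) * q)                         ≡⟨ eq₁ k m c q ⟩
    (k * k + c * k + 1 * (m * k) + c * m * 1) * q
      ≤⟨ *-monoˡ-≤ q (+-mono-≤ (+-monoʳ-≤ (k * k + c * k) (*-monoˡ-≤ (m * k) (m^n>0 (suc (2 * m)) n)))
                               (*-monoʳ-≤ (c * m) (>-nonZero⁻¹ k))) ⟩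
    (k * k + c * k + c * (m * k) + c * m * k) * q   ≡⟨ eq₂ k m c q ⟩
    (k + suc (2 * m) * c) * (k * q)                 ∎
    where
    open ≤-Reasoning
    c = suc (2 * m) ^ n
    q = k ^ n
    eq₁ : ∀ k m c q → (k + m) * ((k + c) * q) ≡ (k * k + c * k + 1 * (m * k) + c * m * 1) * q
    eq₁ = solve-∀
    eq₂ : ∀ k m c q → (k * k + c * k + c * (m * k) + c * m * k) * q ≡ (k + suc (2 * m) * c) * (k * q)
    eq₂ = solve-∀

  -- Bernoulli's inequality (1 - m/k)^n ≥ 1 - nm/k with denominators cleared. Truncation does no
  -- harm, since k ≤ m + (k ∸ m) holds in all cases.
  k^n*k≤ : ∀ m n k → k ^ n * k ≤ (k ∸ m) ^ n * k + n * m * k ^ n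
  k^n*k≤ m zero    k = m≤m+n _ _
  k^n*k≤ m (suc n) k = begin
    k * q * k                                     ≡⟨ *-assoc k q k ⟩
    k * (q * k)                                   ≤⟨ *-monoʳ-≤ k (k^n*k≤ m n k) ⟩
    k * (p * k + n * m * q)                       ≡⟨ eq₁ k p (n * m) q ⟩
    k * (p * k) + k * (n * m * q)                 ≤⟨ +-monoˡ-≤ _ (*-monoˡ-≤ (p * k) (m≤n+m∸n k m)) ⟩
    (m + (k ∸ m)) * (p * k) + k * (n * m * q)     ≡⟨ eq₂ m (k ∸ m) p k (n * m) q ⟩
    (k ∸ m) * p * k + (m * k * p + n * m * (k * q))
      ≤⟨ +-monoʳ-≤ ((k ∸ m) * p * k) (+-monoˡ-≤ _ (*-monoʳ-≤ (m * k) (^-monoˡ-≤ n (m∸n≤m k m)))) ⟩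
    (k ∸ m) * p * k + (m * k * q + n * m * (k * q)) ≡⟨ eq₃ ((k ∸ m) * p * k) m k q n ⟩
    (k ∸ m) * p * k + suc n * m * (k * q)         ∎
    where
    open ≤-Reasoning
    p = (k ∸ m) ^ n
    q = k ^ n
    eq₁ : ∀ k p a q → k * (p * k + a * q) ≡ k * (p * k) + k * (a * q)
    eq₁ = solve-∀
    eq₂ : ∀ m l p k a q → (m + l) * (p * k) + k * (a * q) ≡ l * p * k + (m * k * p + a * (k * q))
    eq₂ = solve-∀
    eq₃ : ∀ a m k q n → a + (m * k * q + n * m * (k * q)) ≡ a + suc n * m * (k * q)
    eq₃ = solve-∀

  d!∣ball∣≥∸ : ∀ d k → 2 ^ d * (k ∸ d) ^ d ≤ d ! * ∣ball∣ d k
  d!∣ball∣≥∸ d k with ≤-total d k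
  ... | inj₁ d≤k = subst (λ z → 2 ^ d * (k ∸ d) ^ d ≤ d ! * ∣ball∣ d z) (m∸n+n≡m d≤k) (d!∣ball∣≥ d (k ∸ d))
  -- The truncated power vanishes only for positive exponent; 0 ^ 0 is 1.
  d!∣ball∣≥∸ zero    k | inj₂ _ = ≤-refl
  d!∣ball∣≥∸ (suc d) k | inj₂ k≤d rewrite m≤n⇒m∸n≡0 k≤d = ≤-trans (≤-reflexive (*-zeroʳ (2 ^ suc d))) z≤n

  -- The sum of the upper and the lower error constant, so that a single C / k bounds the deviation
  -- on both sides.
  errorBound : ℕ → ℕ
  errorBound d = 2 ^ d * (suc (2 * d) ^ d + d * d)

  ∣ball∣-upper : ∀ d k .{{_ : NonZero k}} → d ! * ∣ball∣ d k * k ≤ (2 ^ d * k + errorBound d) * k ^ d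
  ∣ball∣-upper d k = begin
    d ! * ∣ball∣ d k * k                ≤⟨ *-monoˡ-≤ k (d!∣ball∣≤ d k) ⟩
    2 ^ d * (k + d) ^ d * k             ≡⟨ *-assoc (2 ^ d) _ k ⟩
    2 ^ d * ((k + d) ^ d * k)           ≤⟨ *-monoʳ-≤ (2 ^ d) (k*[k+m]^n≤ d d k) ⟩
    2 ^ d * ((k + c) * k ^ d)           ≤⟨ *-monoʳ-≤ (2 ^ d) (*-monoˡ-≤ (k ^ d) (+-monoʳ-≤ k (m≤m+n c (d * d)))) ⟩
    2 ^ d * ((k + (c + d * d)) * k ^ d) ≡⟨ eq (2 ^ d) k (c + d * d) (k ^ d) ⟩
    (2 ^ d * k + errorBound d) * k ^ d  ∎
    where
    open ≤-Reasoning
    c = suc (2 * d) ^ d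
    eq : ∀ t k c q → t * ((k + c) * q) ≡ (t * k + t * c) * q
    eq = solve-∀

  ∣ball∣-lower : ∀ d k → 2 ^ d * k ^ d * k ≤ d ! * ∣ball∣ d k * k + errorBound d * k ^ d
  ∣ball∣-lower d k = begin
    2 ^ d * k ^ d * k                                      ≡⟨ *-assoc (2 ^ d) _ k ⟩
    2 ^ d * (k ^ d * k)                                    ≤⟨ *-monoʳ-≤ (2 ^ d) (k^n*k≤ d d k) ⟩
    2 ^ d * ((k ∸ d) ^ d * k + d * d * k ^ d)
      ≤⟨ *-monoʳ-≤ (2 ^ d) (+-monoʳ-≤ ((k ∸ d) ^ d * k) (*-monoˡ-≤ (k ^ d) (m≤n+m (d * d) c))) ⟩
    2 ^ d * ((k ∸ d) ^ d * k + (c + d * d) * k ^ d)        ≡⟨ eq (2 ^ d) ((k ∸ d) ^ d) k (c + d * d) (k ^ d) ⟩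
    2 ^ d * (k ∸ d) ^ d * k + errorBound d * k ^ d         ≤⟨ +-monoˡ-≤ _ (*-monoˡ-≤ k (d!∣ball∣≥∸ d k)) ⟩
    d ! * ∣ball∣ d k * k + errorBound d * k ^ d            ∎
    where
    open ≤-Reasoning
    c = suc (2 * d) ^ d
    eq : ∀ t p k c q → t * (p * k + c * q) ≡ t * p * k + t * c * q
    eq = solve-∀

-- Rational arithmetic

module Polytope where

  open import Data.Rational using (_/_; _+_; _*_; _-_; -_; _≤_; _<_; ∣_∣)
  open LatticeBall

  -- Rationals are stored in lowest terms. Passing to unnormalised fractions reduces the arithmetic
  -- below to cross multiplication, with no gcd in sight.
  toℚᵘ-/ : ∀ i d → toℚᵘ (i / suc d) ℚᵘ.≃ mkℚᵘ i d
  toℚᵘ-/ i d = ℚₚ.toℚᵘ-fromℚᵘ (mkℚᵘ i d)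

  ι : ℤ → ℚ
  ι z = z / 1

  ι-injective : ∀ {a b} → ι a ≡ ι b → a ≡ b
  ι-injective {a} {b} eq
    with *≡* p ← ℚₚ.fromℚᵘ-injective {mkℚᵘ a 0} {mkℚᵘ b 0} eq =
    trans (sym (ℤₚ.*-identityʳ a)) (trans p (ℤₚ.*-identityʳ b))

  ι-+ : ∀ a b → ι (a ℤ.+ b) ≡ ι a + ι b
  ι-+ a b = ℚₚ.toℚᵘ-injective (begin
    toℚᵘ (ι (a ℤ.+ b))            ≈⟨ toℚᵘ-/ (a ℤ.+ b) 0 ⟩
    mkℚᵘ (a ℤ.+ b) 0
      ≈⟨ *≡* (cong (ℤ._* (+ 1)) (sym (cong₂ ℤ._+_ (ℤₚ.*-identityʳ a) (ℤₚ.*-identityʳ b)))) ⟩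
    mkℚᵘ a 0 ℚᵘ.+ mkℚᵘ b 0        ≈⟨ ℚᵘₚ.+-cong (toℚᵘ-/ a 0) (toℚᵘ-/ b 0) ⟨
    toℚᵘ (ι a) ℚᵘ.+ toℚᵘ (ι b)    ≈⟨ ℚₚ.toℚᵘ-homo-+ (ι a) (ι b) ⟨
    toℚᵘ (ι a + ι b)              ∎)
    where open ℚᵘₚ.≃-Reasoning

  ι-* : ∀ a b → ι (a ℤ.* b) ≡ ι a * ι b
  ι-* a b = ℚₚ.toℚᵘ-injective (begin
    toℚᵘ (ι (a ℤ.* b))            ≈⟨ toℚᵘ-/ (a ℤ.* b) 0 ⟩
    mkℚᵘ a 0 ℚᵘ.* mkℚᵘ b 0        ≈⟨ ℚᵘₚ.*-cong (toℚᵘ-/ a 0) (toℚᵘ-/ b 0) ⟨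
    toℚᵘ (ι a) ℚᵘ.* toℚᵘ (ι b)    ≈⟨ ℚₚ.toℚᵘ-homo-* (ι a) (ι b) ⟨
    toℚᵘ (ι a * ι b)              ∎)
    where open ℚᵘₚ.≃-Reasoning

  ι-neg : ∀ a → ι (ℤ.- a) ≡ - ι a
  ι-neg (+ zero)    = refl
  ι-neg (+ suc n)   = refl
  ι-neg ℤ.-[1+ n ]  = sym (⁻¹-involutive (ι (+ suc n)))

  ι-∣∣ : ∀ a → ι (+ ℤ.∣ a ∣) ≡ ∣ ι a ∣
  ι-∣∣ a = ℚₚ.toℚᵘ-injective (begin
    toℚᵘ (ι (+ ℤ.∣ a ∣))   ≈⟨ toℚᵘ-/ (+ ℤ.∣ a ∣) 0 ⟩
    ℚᵘ.∣ mkℚᵘ a 0 ∣        ≈⟨ ℚᵘₚ.∣-∣-cong (toℚᵘ-/ a 0) ⟨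
    ℚᵘ.∣ toℚᵘ (ι a) ∣      ≈⟨ ℚₚ.toℚᵘ-homo-∣-∣ (ι a) ⟨
    toℚᵘ ∣ ι a ∣           ∎)
    where open ℚᵘₚ.≃-Reasoning

  /-mono-≤ : ∀ a b c d → a ℕ.* suc d ℕ.≤ b ℕ.* suc c → (+ a) / suc c ≤ (+ b) / suc d
  /-mono-≤ a b c d le = ℚₚ.toℚᵘ-cancel-≤
    (ℚᵘₚ.≤-respˡ-≃ (ℚᵘₚ.≃-sym (toℚᵘ-/ (+ a) c)) (ℚᵘₚ.≤-respʳ-≃ (ℚᵘₚ.≃-sym (toℚᵘ-/ (+ b) d))
      (*≤* (subst₂ ℤ._≤_ (ℤₚ.pos-* a (suc d)) (ℤₚ.pos-* b (suc c)) (ℤ.+≤+ le)))))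

  ι-mono-≤ : ∀ a b → a ℕ.≤ b → ι (+ a) ≤ ι (+ b)
  ι-mono-≤ a b le = /-mono-≤ a b 0 0 (ℕₚ.*-monoˡ-≤ 1 le)

  ι-cancel-≤ : ∀ a b → ι (+ a) ≤ ι (+ b) → a ℕ.≤ b
  ι-cancel-≤ a b le
    with *≤* p ← ℚᵘₚ.≤-respˡ-≃ (toℚᵘ-/ (+ a) 0) (ℚᵘₚ.≤-respʳ-≃ (toℚᵘ-/ (+ b) 0) (ℚₚ.toℚᵘ-mono-≤ le)) =
    ℤₚ.drop‿+≤+ (subst₂ ℤ._≤_ (ℤₚ.*-identityʳ (+ a)) (ℤₚ.*-identityʳ (+ b)) p)

  ∣p-q∣≤r : ∀ {p q r} → p ≤ q + r → q ≤ p + r → ∣ p - q ∣ ≤ r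
  ∣p-q∣≤r {p} {q} {r} le₁ le₂ with ℚₚ.∣p∣≡p∨∣p∣≡-p (p - q)
  ... | inj₁ eq = subst (_≤ r) (sym eq) (begin
    p - q        ≤⟨ ℚₚ.+-monoˡ-≤ (- q) le₁ ⟩
    (q + r) - q  ≡⟨ solve 2 (λ q r → ((q :+ r) :- q) := r) refl q r ⟩
    r            ∎)
    where
    open ℚₚ.≤-Reasoning
    open +-*-Solver
  ... | inj₂ eq = subst (_≤ r) (sym eq) (begin
    - (p - q)    ≡⟨ solve 2 (λ p q → (:- (p :- q)) := (q :- p)) refl p q ⟩
    q - p        ≤⟨ ℚₚ.+-monoˡ-≤ (- p) le₂ ⟩
    (p + r) - p  ≡⟨ solve 2 (λ q r → ((q :+ r) :- q) := r) refl p r ⟩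
    r            ∎)
    where
    open ℚₚ.≤-Reasoning
    open +-*-Solver

  /-+-/ : ∀ a b c d → (+ a) / suc c + (+ b) / suc d ≡
          (+ (a ℕ.* suc d ℕ.+ b ℕ.* suc c)) / suc (d ℕ.+ c ℕ.* suc d)
  /-+-/ a b c d = ℚₚ.toℚᵘ-injective (begin
    toℚᵘ ((+ a) / suc c + (+ b) / suc d)
      ≈⟨ ℚₚ.toℚᵘ-homo-+ ((+ a) / suc c) ((+ b) / suc d) ⟩
    toℚᵘ ((+ a) / suc c) ℚᵘ.+ toℚᵘ ((+ b) / suc d)
      ≈⟨ ℚᵘₚ.+-cong (toℚᵘ-/ (+ a) c) (toℚᵘ-/ (+ b) d) ⟩
    mkℚᵘ (+ a ℤ.* + suc d ℤ.+ + b ℤ.* + suc c) (d ℕ.+ c ℕ.* suc d)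
      ≡⟨ cong (λ z → mkℚᵘ z (d ℕ.+ c ℕ.* suc d)) numerators ⟨
    mkℚᵘ (+ (a ℕ.* suc d ℕ.+ b ℕ.* suc c)) (d ℕ.+ c ℕ.* suc d)
      ≈⟨ toℚᵘ-/ _ (d ℕ.+ c ℕ.* suc d) ⟨
    toℚᵘ ((+ (a ℕ.* suc d ℕ.+ b ℕ.* suc c)) / suc (d ℕ.+ c ℕ.* suc d)) ∎)
    where
    open ℚᵘₚ.≃-Reasoning
    numerators : + (a ℕ.* suc d ℕ.+ b ℕ.* suc c) ≡ + a ℤ.* + suc d ℤ.+ + b ℤ.* + suc c
    numerators = trans (ℤₚ.pos-+ (a ℕ.* suc d) (b ℕ.* suc c))
                       (cong₂ ℤ._+_ (ℤₚ.pos-* a (suc d)) (ℤₚ.pos-* b (suc c)))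

  -- The hypotheses divided by D k say a/D ≤ V + C/k and V ≤ a/D + C/k. They have the shape of
  -- `∣ball∣-upper` and `∣ball∣-lower`, with D = k^d and V = 2^d.
  ∣a/D-V∣≤C/k : ∀ a V C D k .{{_ : NonZero D}} .{{_ : NonZero k}} →
    a ℕ.* k ℕ.≤ (V ℕ.* k ℕ.+ C) ℕ.* D → V ℕ.* D ℕ.* k ℕ.≤ a ℕ.* k ℕ.+ C ℕ.* D →
    ∣ (+ a) / D - ι (+ V) ∣ ≤ (+ C) / k
  ∣a/D-V∣≤C/k a V C (suc D) (suc k) le₁ le₂ = ∣p-q∣≤r
    (subst ((+ a) / suc D ≤_) (sym (/-+-/ V C 0 k))
      (/-mono-≤ a (V ℕ.* suc k ℕ.+ C ℕ.* 1) D _ (subst₂ ℕ._≤_ (eq₁ a k) (eq₂ V k C D) le₁)))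
    (subst (ι (+ V) ≤_) (sym (/-+-/ a C D k))
      (/-mono-≤ V (a ℕ.* suc k ℕ.+ C ℕ.* suc D) 0 _ (subst₂ ℕ._≤_ (eq₃ V k D) (eq₄ a k C D) le₂)))
    where
    eq₁ : ∀ a k → a ℕ.* suc k ≡ a ℕ.* suc (k ℕ.+ 0)
    eq₁ = solve-∀
    eq₂ : ∀ V k C D → (V ℕ.* suc k ℕ.+ C) ℕ.* suc D ≡ (V ℕ.* suc k ℕ.+ C ℕ.* 1) ℕ.* suc D
    eq₂ = solve-∀
    eq₃ : ∀ V k D → V ℕ.* suc D ℕ.* suc k ≡ V ℕ.* suc (k ℕ.+ D ℕ.* suc k)
    eq₃ = solve-∀
    eq₄ : ∀ a k C D → a ℕ.* suc k ℕ.+ C ℕ.* suc D ≡ (a ℕ.* suc k ℕ.+ C ℕ.* suc D) ℕ.* 1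
    eq₄ = solve-∀

  C/k-small : ∀ C ε → 0ℚ < ε → ∃[ K ] (∀ k .{{_ : NonZero k}} → K ℕ.≤ k → (+ C) / k < ε)
  -- Here ε = (p+1)/(q+1) is at least 1/(q+1), so k > C (q+1) suffices.
  C/k-small C ε@(mkℚ (+ suc p) q _) _ = suc (C ℕ.* suc q) , small
    where
    small : ∀ k .{{_ : NonZero k}} → suc (C ℕ.* suc q) ℕ.≤ k → (+ C) / k < ε
    small (suc k) K≤k = ℚₚ.toℚᵘ-cancel-<
      (ℚᵘₚ.<-respˡ-≃ (ℚᵘₚ.≃-sym (toℚᵘ-/ (+ C) k))
        (*<* (subst (ℤ._< + (suc p ℕ.* suc k)) (ℤₚ.pos-* C (suc q))
          (ℤ.+<+ (ℕₚ.<-≤-trans K≤k (ℕₚ.m≤n*m (suc k) (suc p)))))))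
  C/k-small C (mkℚ (+ zero) q _) (ℚ.*<* (ℤ.+<+ ()))
  C/k-small C (mkℚ ℤ.-[1+ n ] q _) (ℚ.*<* ())

  0≤1/ : ∀ k .{{_ : NonZero k}} → 0ℚ ≤ (+ 1) / k
  0≤1/ (suc k) = /-mono-≤ 0 1 0 k z≤n

  k*1/k : ∀ k .{{_ : NonZero k}} → ι (+ k) * ((+ 1) / k) ≡ 1ℚ
  k*1/k (suc k) = ℚₚ.toℚᵘ-injective (begin
    toℚᵘ (ι (+ suc k) * ((+ 1) / suc k))          ≈⟨ ℚₚ.toℚᵘ-homo-* (ι (+ suc k)) ((+ 1) / suc k) ⟩
    toℚᵘ (ι (+ suc k)) ℚᵘ.* toℚᵘ ((+ 1) / suc k)  ≈⟨ ℚᵘₚ.*-cong (toℚᵘ-/ (+ suc k) 0) (toℚᵘ-/ (+ 1) k) ⟩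
    mkℚᵘ (+ suc k) 0 ℚᵘ.* mkℚᵘ (+ 1) k            ≈⟨ *≡* (cong +_ (eq k)) ⟩
    toℚᵘ 1ℚ                                       ∎)
    where
    open ℚᵘₚ.≃-Reasoning
    eq : ∀ k → suc k ℕ.* 1 ℕ.* 1 ≡ 1 ℕ.* (1 ℕ.* suc k)
    eq = solve-∀

  -- Linear combinations and the ℓ¹ norm

  e-sym : ∀ {n} (u v : Fin n) → e u v ≡ e v u
  e-sym zero    zero    = refl
  e-sym zero    (suc v) = refl
  e-sym (suc u) zero    = refl
  e-sym (suc u) (suc v) = e-sym u v

  sum-zero : ∀ {n} (f : Vector ℚ n) → (∀ i → f i ≡ 0ℚ) → sum f ≡ 0ℚ
  sum-zero {n} f f≗0 = trans (sum-cong-≗ f≗0) (sum-replicate-zero n)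

  sum-*-e : ∀ {n} (f : Vector ℚ n) u → sum (λ v → f v * e u v) ≡ f u
  sum-*-e {suc n} f zero = trans
    (cong₂ _+_ (ℚₚ.*-identityʳ (f zero)) (sum-zero (λ v → f (suc v) * 0ℚ) (λ v → ℚₚ.*-zeroʳ (f (suc v)))))
    (ℚₚ.+-identityʳ (f zero))
  sum-*-e {suc n} f (suc u) = trans
    (cong₂ _+_ (ℚₚ.*-zeroʳ (f zero)) (sum-*-e (f ∘ suc) u))
    (ℚₚ.+-identityˡ (f (suc u)))

  sum-mono-≤ : ∀ {n} (f g : Vector ℚ n) → (∀ i → f i ≤ g i) → sum f ≤ sum g
  sum-mono-≤ {zero}  f g f≤g = ℚₚ.≤-refl
  sum-mono-≤ {suc n} f g f≤g = ℚₚ.+-mono-≤ (f≤g zero) (sum-mono-≤ (f ∘ suc) (g ∘ suc) (f≤g ∘ suc))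

  ∣sum∣≤ : ∀ {n} (f : Vector ℚ n) → ∣ sum f ∣ ≤ sum (∣_∣ ∘ f)
  ∣sum∣≤ {zero}  f = ℚₚ.≤-refl
  ∣sum∣≤ {suc n} f = ℚₚ.≤-trans (ℚₚ.∣p+q∣≤∣p∣+∣q∣ (f zero) (sum (f ∘ suc))) (ℚₚ.+-monoʳ-≤ ∣ f zero ∣ (∣sum∣≤ (f ∘ suc)))

  ι-sum : ∀ {n} (f : Vector ℤ n) → ι (ℤ-Sum.sum f) ≡ sum (ι ∘ f)
  ι-sum {zero}  f = refl
  ι-sum {suc n} f = trans (ι-+ (f zero) (ℤ-Sum.sum (f ∘ suc))) (cong (λ s → ι (f zero) + s) (ι-sum (f ∘ suc)))

  module _ {m n : ℕ} where

    combination-congˡ : ∀ {c c′} (p : Fin m → Vector ℚ n) → c ≗ c′ → combination c p ≗ combination c′ p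
    combination-congˡ p eq v = sum-cong-≗ (λ k → cong (_* p k v) (eq k))

    combination-congʳ : ∀ c {p p′ : Fin m → Vector ℚ n} → (∀ k → p k ≗ p′ k) → combination c p ≗ combination c p′
    combination-congʳ c eq v = sum-cong-≗ (λ k → cong (c k *_) (eq k v))

    combination-* : ∀ r c (p : Fin m → Vector ℚ n) →
                    combination (λ k → r * c k) p ≗ (λ v → r * combination c p v)
    combination-* r c p v = trans (sum-cong-≗ (λ k → ℚₚ.*-assoc r (c k) (p k v)))
                                  (sym (*-distribˡ-sum r (λ k → c k * p k v)))

  -- Reading `p` as a matrix by rows, `combination c p` is a row vector times a matrix, and this is
  -- associativity of the matrix product.
  combination-assoc : ∀ {l m n} c (q : Fin l → Vector ℚ m) (p : Fin m → Vector ℚ n) →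
    combination (combination c q) p ≗ combination c (λ i → combination (q i) p)
  combination-assoc c q p v = begin
    sum (λ j → sum (λ i → c i * q i j) * p j v)
      ≡⟨ sum-cong-≗ (λ j → *-distribʳ-sum (p j v) (λ i → c i * q i j)) ⟩
    sum (λ j → sum (λ i → c i * q i j * p j v))
      ≡⟨ ∑-comm (λ j i → c i * q i j * p j v) ⟩
    sum (λ i → sum (λ j → c i * q i j * p j v))
      ≡⟨ sum-cong-≗ (λ i → combination-* (c i) (q i) p v) ⟩
    sum (λ i → c i * sum (λ j → q i j * p j v)) ∎
    where open ≡-Reasoning

  combination-e : ∀ {m n} j (p : Fin m → Vector ℚ n) → combination (e j) p ≗ p j
  combination-e j p v = trans (sum-cong-≗ (λ k → ℚₚ.*-comm (e j k) (p k v))) (sum-*-e (λ k → p k v) j)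

  combinationᶻ : ∀ {m n} → Vector ℤ m → (Fin m → Vector ℤ n) → Vector ℤ n
  combinationᶻ c p v = ℤ-Sum.sum (λ k → c k ℤ.* p k v)

  ι-combination : ∀ {m n} c (p : Fin m → Vector ℤ n) v →
    ι (combinationᶻ c p v) ≡ combination (ι ∘ c) (λ k → ι ∘ p k) v
  ι-combination c p v = trans (ι-sum (λ k → c k ℤ.* p k v)) (sum-cong-≗ (λ k → ι-* (c k) (p k v)))

  ‖_‖ : ∀ {n} → Vector ℚ n → ℚ
  ‖ y ‖ = sum (∣_∣ ∘ y)

  ‖‖-cong : ∀ {n} {y z : Vector ℚ n} → y ≗ z → ‖ y ‖ ≡ ‖ z ‖
  ‖‖-cong eq = sum-cong-≗ (cong ∣_∣ ∘ eq)

  ‖‖-* : ∀ {n} r (y : Vector ℚ n) → 0ℚ ≤ r → ‖ (λ j → r * y j) ‖ ≡ r * ‖ y ‖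
  ‖‖-* r y 0≤r = trans
    (sum-cong-≗ (λ j → trans (ℚₚ.∣p*q∣≡∣p∣*∣q∣ r (y j)) (cong (_* ∣ y j ∣) (ℚₚ.0≤p⇒∣p∣≡p 0≤r))))
    (sym (*-distribˡ-sum r (∣_∣ ∘ y)))

  ‖combination‖≤1 : ∀ {m n} c (q : Fin m → Vector ℚ n) → (∀ i → 0ℚ ≤ c i) → sum c ≡ 1ℚ →
                    (∀ i → ‖ q i ‖ ≤ 1ℚ) → ‖ combination c q ‖ ≤ 1ℚ
  ‖combination‖≤1 c q 0≤c Σc≡1 q≤1 = begin
    sum (λ j → ∣ sum (λ i → c i * q i j) ∣)
      ≤⟨ sum-mono-≤ _ _ (λ j → ∣sum∣≤ (λ i → c i * q i j)) ⟩
    sum (λ j → sum (λ i → ∣ c i * q i j ∣))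
      ≡⟨ ∑-comm (λ j i → ∣ c i * q i j ∣) ⟩
    sum (λ i → ‖ (λ j → c i * q i j) ‖)
      ≡⟨ sum-cong-≗ (λ i → ‖‖-* (c i) (q i) (0≤c i)) ⟩
    sum (λ i → c i * ‖ q i ‖)
      ≤⟨ sum-mono-≤ _ _ (λ i → ℚₚ.*-monoˡ-≤-nonNeg (c i) {{ℚ.nonNegative (0≤c i)}} (q≤1 i)) ⟩
    sum (λ i → c i * 1ℚ)
      ≡⟨ sum-cong-≗ (λ i → ℚₚ.*-identityʳ (c i)) ⟩
    sum c
      ≡⟨ Σc≡1 ⟩
    1ℚ ∎
    where open ℚₚ.≤-Reasoning

  ‖e‖ : ∀ {n} (j : Fin n) → ‖ e j ‖ ≡ 1ℚ
  ‖e‖ j = trans (sum-cong-≗ (λ k → trans (abs-e k) (sym (ℚₚ.*-identityˡ (e j k))))) (sum-*-e (λ _ → 1ℚ) j)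
    where
    abs-e : ∀ k → ∣ e j k ∣ ≡ e j k
    abs-e k with does (j ≟ k)
    ... | true  = refl
    ... | false = refl

  ‖ι‖ : ∀ {n} (z : Vec ℤ n) → ‖ ι ∘ lookup z ‖ ≡ ι (+ ℓ¹ z)
  ‖ι‖ []      = refl
  ‖ι‖ (x ∷ z) = trans (cong₂ _+_ (sym (ι-∣∣ x)) (‖ι‖ z)) (sym (ι-+ (+ ℤ.∣ x ∣) (+ ℓ¹ z)))

  eᶻ : ∀ {n} → Fin n → Vector ℤ n
  eᶻ u v = if does (u ≟ v) then 1ℤ else 0ℤ

  ι-eᶻ : ∀ {n} (u v : Fin n) → ι (eᶻ u v) ≡ e u v
  ι-eᶻ u v with does (u ≟ v)
  ... | true  = refl
  ... | false = refl

  eᶻ-diag : ∀ {n} (u : Fin n) → eᶻ u u ≡ 1ℤ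
  eᶻ-diag u = cong (if_then 1ℤ else 0ℤ) (dec-true (u ≟ u) refl)

  ι-minus : ∀ a b → ι (a ℤ.- b) ≡ ι a - ι b
  ι-minus a b = trans (ι-+ a (ℤ.- b)) (cong (λ z → ι a + z) (ι-neg b))

  ι-lookup-injective : ∀ {n} {x y : Vec ℤ n} → ι ∘ lookup x ≗ ι ∘ lookup y → x ≡ y
  ι-lookup-injective {x = x} {y} eq =
    trans (sym (tabulate∘lookup x)) (trans (tabulate-cong (ι-injective ∘ eq)) (tabulate∘lookup y))

  -- Polytopes of bidirected trees

  -- The functionals φ k form a basis dual to the arc vectors, so the latter are
  -- the images of a lattice basis under a unimodular map onto the lattice in
  -- their span.
  module Bidirected {d n : ℕ} (head tail : Fin (suc d) → Fin n) (φ : Fin (suc d) → Vector ℤ n)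
    (φ-dual : ∀ j k → φ k (head j) ℤ.- φ k (tail j) ≡ eᶻ j k) where

    graph : Digraph
    graph = record
      { order    = n
      ; Arc      = λ w v → ∃[ j ] ((w ≡ tail j × v ≡ head j) ⊎ (w ≡ head j × v ≡ tail j))
      ; arc?     = λ w v → any? λ j → ((w ≟ tail j) ×-dec (v ≟ head j)) ⊎-dec ((w ≟ head j) ×-dec (v ≟ tail j))
      ; loopless = λ { refl (j , inj₁ (p , q)) → head≢tail j (trans (sym q) p)
                     ; refl (j , inj₂ (p , q)) → head≢tail j (trans (sym p) q) }
      }
      where
      head≢tail : ∀ j → head j ≢ tail j
      -- Were the ends equal, `φ j` would differ by 0 across edge `j`, whereas duality makes the
      -- difference 1.
      head≢tail j eq with () ← trans (sym (ℤₚ.+-inverseʳ (φ j (tail j))))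
        (trans (cong (λ u → φ j u ℤ.- φ j (tail j)) (sym eq)) (trans (φ-dual j j) (eᶻ-diag j)))

    open Digraph graph using (Arc)

    IsArcVector : Vector ℚ n → Set
    IsArcVector x = ∃[ w ] ∃[ v ] Arc w v × x ≗ (λ t → e v t - e w t)

    -- Coordinates on the span of the arc vectors

    b : Fin (suc d) → Vector ℚ n
    b j t = e (head j) t - e (tail j) t

    b⁻ : Fin (suc d) → Vector ℚ n
    b⁻ j t = e (tail j) t - e (head j) t

    b⁻≡-b : ∀ j t → b⁻ j t ≡ - b j t
    b⁻≡-b j t = solve 2 (λ p q → (q :- p) := (:- (p :- q))) refl (e (head j) t) (e (tail j) t)
      where open +-*-Solver

    embed : Vector ℚ (suc d) → Vector ℚ n
    embed y = combination y b

    φᵀ : Fin n → Vector ℤ (suc d)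
    φᵀ v k = φ k v

    -- Evaluates all functionals at once, extended linearly from the vertices. The transposed family
    -- makes this a `combination`, to which `combination-assoc` applies.
    coordinates : Vector ℚ n → Vector ℚ (suc d)
    coordinates x = combination x (λ v → ι ∘ φᵀ v)

    coordinates-b : ∀ j → coordinates (b j) ≗ e j
    coordinates-b j k = begin
      sum (λ v → b j v * ι (φ k v))
        ≡⟨ sum-cong-≗ (λ v → expand (e (head j) v) (e (tail j) v) (ι (φ k v))) ⟩
      sum (λ v → ι (φ k v) * e (head j) v + (- ι (φ k v)) * e (tail j) v)
        ≡⟨ ∑-distrib-+ (λ v → ι (φ k v) * e (head j) v) (λ v → (- ι (φ k v)) * e (tail j) v) ⟩
      sum (λ v → ι (φ k v) * e (head j) v) + sum (λ v → (- ι (φ k v)) * e (tail j) v)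
        ≡⟨ cong₂ _+_ (sum-*-e (ι ∘ φ k) (head j)) (sum-*-e (-_ ∘ ι ∘ φ k) (tail j)) ⟩
      ι (φ k (head j)) - ι (φ k (tail j))
        ≡⟨ ι-minus (φ k (head j)) (φ k (tail j)) ⟨
      ι (φ k (head j) ℤ.- φ k (tail j))
        ≡⟨ cong ι (φ-dual j k) ⟩
      ι (eᶻ j k)
        ≡⟨ ι-eᶻ j k ⟩
      e j k ∎
      where
      open ≡-Reasoning
      expand : ∀ p q r → (p - q) * r ≡ r * p + (- r) * q
      expand = solve 3 (λ p q r → ((p :- q) :* r) := (r :* p :+ (:- r) :* q)) refl
        where open +-*-Solver

    -- Duality says that the matrix of the `b j` times that of the functionals is the identity.
    -- Since both are integral, this left inverse is the unimodularity on which independence,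
    -- injectivity and integrality of coefficients rest.
    coordinates-embed : ∀ y → coordinates (embed y) ≗ y
    coordinates-embed y k = begin
      coordinates (embed y) k                   ≡⟨ combination-assoc y b (λ v → ι ∘ φᵀ v) k ⟩
      combination y (λ j → coordinates (b j)) k ≡⟨ combination-congʳ y coordinates-b k ⟩
      combination y e k                         ≡⟨ sum-cong-≗ (λ j → cong (y j *_) (e-sym j k)) ⟩
      sum (λ j → y j * e k j)                   ≡⟨ sum-*-e y k ⟩
      y k ∎
      where open ≡-Reasoning

    -- The polytope as the image of the ℓ¹ unit ball

    arcVector⁻ : ∀ {x} → IsArcVector x → ∃[ y ] ‖ y ‖ ≤ 1ℚ × x ≗ embed y
    arcVector⁻ (_ , _ , (j , inj₁ (refl , refl)) , eq) =
      e j , ℚₚ.≤-reflexive (‖e‖ j) , λ v → trans (eq v) (sym (combination-e j b v))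
    arcVector⁻ (_ , _ , (j , inj₂ (refl , refl)) , eq) =
      (λ k → - e j k) ,
      ℚₚ.≤-reflexive (trans (sum-cong-≗ (λ k → ℚₚ.∣-p∣≡∣p∣ (e j k))) (‖e‖ j)) ,
      λ v → trans (eq v) (trans (b⁻≡-b j v) (sym (embed-neg v)))
      where
      embed-neg : ∀ v → embed (λ k → - e j k) v ≡ - b j v
      embed-neg v = begin
        embed (λ k → - e j k) v          ≡⟨ combination-congˡ b (λ k → sym (-1*x≈-x (e j k))) v ⟩
        embed (λ k → (- 1ℚ) * e j k) v   ≡⟨ combination-* (- 1ℚ) (e j) b v ⟩
        (- 1ℚ) * embed (e j) v           ≡⟨ cong ((- 1ℚ) *_) (combination-e j b v) ⟩
        (- 1ℚ) * b j v                   ≡⟨ -1*x≈-x (b j v) ⟩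
        - b j v                          ∎
        where open ≡-Reasoning

    polytope⁻ : ∀ {x} → EdgePolytope graph x → ∃[ y ] ‖ y ‖ ≤ 1ℚ × x ≗ embed y
    polytope⁻ (m , p , c , p∈ , 0≤c , Σc≡1 , x≗) =
      combination c q , ‖combination‖≤1 c q 0≤c Σc≡1 (λ i → proj₁ (proj₂ (arcVector⁻ (p∈ i)))) ,
      λ v → trans (x≗ v) (trans (combination-congʳ c (λ i → proj₂ (proj₂ (arcVector⁻ (p∈ i)))) v)
                                (sym (combination-assoc c q b v)))
      where
      q : Fin m → Vector ℚ (suc d)
      q i = proj₁ (arcVector⁻ (p∈ i))

    -- Besides the vertices ± b j carrying the weights ∣y j∣, the remaining weight
    -- is shared by the antipodal pair b zero and b⁻ zero.
    polytope⁺ : ∀ {x} y → ‖ y ‖ ≤ 1ℚ → x ≗ embed y → EdgePolytope graph x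
    polytope⁺ {x} y ‖y‖≤1 x≗ = suc (suc (suc d)) , p , c , p∈ , 0≤c , Σc≡1 ,
      λ v → trans (x≗ v) (sym (combination≡ v))
      where
      r : ℚ
      r = 1ℚ - ‖ y ‖

      signed : ∀ j → Σ[ s ∈ Vector ℚ n ] IsArcVector s × (∀ v → ∣ y j ∣ * s v ≡ y j * b j v)
      signed j with ℚₚ.∣p∣≡p∨∣p∣≡-p (y j)
      ... | inj₁ eq = b j , (tail j , head j , (j , inj₁ (refl , refl)) , λ _ → refl) ,
                      λ v → cong (_* b j v) eq
      ... | inj₂ eq = b⁻ j , (head j , tail j , (j , inj₂ (refl , refl)) , λ _ → refl) ,
                      λ v → trans (cong₂ _*_ eq (b⁻≡-b j v))
                        (solve 2 (λ p q → ((:- p) :* (:- q)) := (p :* q)) refl (y j) (b j v))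
        where open +-*-Solver

      p : Fin (suc (suc (suc d))) → Vector ℚ n
      p zero          = b zero
      p (suc zero)    = b⁻ zero
      p (suc (suc j)) = proj₁ (signed j)

      c : Vector ℚ (suc (suc (suc d)))
      c zero          = ½ * r
      c (suc zero)    = ½ * r
      c (suc (suc j)) = ∣ y j ∣

      p∈ : ∀ i → IsArcVector (p i)
      p∈ zero          = tail zero , head zero , (zero , inj₁ (refl , refl)) , λ _ → refl
      p∈ (suc zero)    = head zero , tail zero , (zero , inj₂ (refl , refl)) , λ _ → refl
      p∈ (suc (suc j)) = proj₁ (proj₂ (signed j))

      0≤½r : 0ℚ ≤ ½ * r
      0≤½r = subst (_≤ ½ * r) (ℚₚ.*-zeroʳ ½) (ℚₚ.*-monoˡ-≤-nonNeg ½
        (subst (_≤ r) (ℚₚ.+-inverseʳ ‖ y ‖) (ℚₚ.+-monoˡ-≤ (- ‖ y ‖) ‖y‖≤1)))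

      0≤c : ∀ i → 0ℚ ≤ c i
      0≤c zero          = 0≤½r
      0≤c (suc zero)    = 0≤½r
      0≤c (suc (suc j)) = ℚₚ.0≤∣p∣ (y j)

      Σc≡1 : sum c ≡ 1ℚ
      Σc≡1 = solve 1 (λ s → con ½ :* (con 1ℚ :- s) :+ (con ½ :* (con 1ℚ :- s) :+ s) := con 1ℚ) refl ‖ y ‖
        where open +-*-Solver

      combination≡ : ∀ v → combination c p v ≡ embed y v
      combination≡ v = begin
        ½ * r * b zero v + (½ * r * b⁻ zero v + sum (λ j → ∣ y j ∣ * proj₁ (signed j) v))
          ≡⟨ cong₂ (λ s t → ½ * r * b zero v + (½ * r * s + t)) (b⁻≡-b zero v)
                   (sum-cong-≗ (λ j → proj₂ (proj₂ (signed j)) v)) ⟩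
        ½ * r * b zero v + (½ * r * (- b zero v) + embed y v)
          ≡⟨ solve 3 (λ h t s → h :* t :+ (h :* (:- t) :+ s) := s) refl (½ * r) (b zero v) (embed y v) ⟩
        embed y v ∎
        where
        open ≡-Reasoning
        open +-*-Solver

    -- Dimension

    dimension : HasDimension (EdgePolytope graph) (suc d)
    dimension = p , p∈ , independent , spans
      where
      p : Fin (suc (suc d)) → Vector ℚ n
      -- The origin is a point of the polytope. As base point it reduces affine independence to
      -- linear independence of the `b j`, and in `spans` it takes up whatever weight is left.
      p zero    = λ _ → 0ℚ
      p (suc j) = b j

      p∈ : ∀ k → EdgePolytope graph (p k)
      p∈ zero = polytope⁺ (λ _ → 0ℚ)
        (subst (_≤ 1ℚ) (sym (sum-zero {suc d} (λ _ → 0ℚ) (λ _ → refl))) (ℚₚ.nonNegative⁻¹ 1ℚ))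
        (λ v → sym (sum-zero (λ j → 0ℚ * b j v) (λ j → ℚₚ.*-zeroˡ (b j v))))
      p∈ (suc j) = polytope⁺ (e j) (ℚₚ.≤-reflexive (‖e‖ j)) (λ v → sym (combination-e j b v))

      drop-origin : ∀ c v → combination c p v ≡ embed (c ∘ suc) v
      drop-origin c v = trans (cong (_+ embed (c ∘ suc) v) (ℚₚ.*-zeroʳ (c zero))) (ℚₚ.+-identityˡ (embed (c ∘ suc) v))

      independent : AffinelyIndependent p
      independent c Σc≡0 cp≗0 = λ { zero → c₀≡0 ; (suc k) → c₊≡0 k }
        where
        c₊≡0 : ∀ k → c (suc k) ≡ 0ℚ
        c₊≡0 k = begin
          c (suc k)                         ≡⟨ coordinates-embed (c ∘ suc) k ⟨
          coordinates (embed (c ∘ suc)) k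
            ≡⟨ combination-congˡ (λ v → ι ∘ φᵀ v) (λ v → trans (sym (drop-origin c v)) (cp≗0 v)) k ⟩
          coordinates (λ _ → 0ℚ) k          ≡⟨ sum-zero (λ v → 0ℚ * ι (φ k v)) (λ v → ℚₚ.*-zeroˡ (ι (φ k v))) ⟩
          0ℚ                                ∎
          where open ≡-Reasoning
        c₀≡0 : c zero ≡ 0ℚ
        c₀≡0 = begin
          c zero                    ≡⟨ ℚₚ.+-identityʳ (c zero) ⟨
          c zero + 0ℚ               ≡⟨ cong (λ s → c zero + s) (sum-zero (c ∘ suc) c₊≡0) ⟨
          sum c                     ≡⟨ Σc≡0 ⟩
          0ℚ                        ∎
          where open ≡-Reasoning

      spans : ∀ x → EdgePolytope graph x → Σ[ c ∈ Vector ℚ (suc (suc d)) ] sum c ≡ 1ℚ × x ≗ combination c p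
      spans x x∈ with y , _ , x≗ ← polytope⁻ x∈ =
        c , solve 1 (λ s → (con 1ℚ :- s) :+ s := con 1ℚ) refl (sum y) ,
        λ v → trans (x≗ v) (sym (drop-origin c v))
        where
        open +-*-Solver
        c : Vector ℚ (suc (suc d))
        c zero    = 1ℚ - sum y
        c (suc j) = y j

    -- Lattice points of the dilates, and volume

    bᶻ : Fin (suc d) → Vector ℤ n
    bᶻ j v = eᶻ (head j) v ℤ.- eᶻ (tail j) v

    ι-bᶻ : ∀ j v → ι (bᶻ j v) ≡ b j v
    ι-bᶻ j v = trans (ι-minus (eᶻ (head j) v) (eᶻ (tail j) v)) (cong₂ _-_ (ι-eᶻ (head j) v) (ι-eᶻ (tail j) v))

    embedᶻ : Vec ℤ (suc d) → Vec ℤ n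
    embedᶻ z = tabulate (combinationᶻ (lookup z) bᶻ)

    coordinatesᶻ : Vec ℤ n → Vec ℤ (suc d)
    coordinatesᶻ x = tabulate (combinationᶻ (lookup x) φᵀ)

    ι-embedᶻ : ∀ z v → ι (lookup (embedᶻ z) v) ≡ embed (ι ∘ lookup z) v
    ι-embedᶻ z v = begin
      ι (lookup (embedᶻ z) v)                               ≡⟨ cong ι (lookup∘tabulate (combinationᶻ (lookup z) bᶻ) v) ⟩
      ι (combinationᶻ (lookup z) bᶻ v)                      ≡⟨ ι-combination (lookup z) bᶻ v ⟩
      combination (ι ∘ lookup z) (λ j → ι ∘ bᶻ j) v         ≡⟨ combination-congʳ (ι ∘ lookup z) ι-bᶻ v ⟩
      embed (ι ∘ lookup z) v                                ∎
      where open ≡-Reasoning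

    ι-coordinatesᶻ : ∀ x k → ι (lookup (coordinatesᶻ x) k) ≡ coordinates (ι ∘ lookup x) k
    ι-coordinatesᶻ x k = trans (cong ι (lookup∘tabulate (combinationᶻ (lookup x) φᵀ) k))
      (ι-combination (lookup x) φᵀ k)

    embedᶻ-injective : ∀ {z z′} → embedᶻ z ≡ embedᶻ z′ → z ≡ z′
    embedᶻ-injective {z} {z′} eq = ι-lookup-injective λ k → begin
      ι (lookup z k)                            ≡⟨ coordinates-embed (ι ∘ lookup z) k ⟨
      coordinates (embed (ι ∘ lookup z)) k      ≡⟨ combination-congˡ (λ v → ι ∘ φᵀ v) embeds k ⟩
      coordinates (embed (ι ∘ lookup z′)) k     ≡⟨ coordinates-embed (ι ∘ lookup z′) k ⟩
      ι (lookup z′ k)                           ∎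
      where
      open ≡-Reasoning
      embeds : embed (ι ∘ lookup z) ≗ embed (ι ∘ lookup z′)
      embeds v = trans (sym (ι-embedᶻ z v)) (trans (cong (λ x → ι (lookup x v)) eq) (ι-embedᶻ z′ v))

    latticeCount : ∀ k .{{_ : NonZero k}} → HasLatticeCount (Dilate k (EdgePolytope graph)) (∣ball∣ (suc d) k)
    latticeCount k = map embedᶻ (ball (suc d) k) , map⁺ embedᶻ-injective (ball-unique (suc d) k) ,
      (λ x → mk⇔ (to x) (from x)) , length-map embedᶻ (ball (suc d) k)
      where
      K = ι (+ k)
      K⁻¹ = + 1 / k

      0≤K⁻¹ : 0ℚ ≤ K⁻¹
      0≤K⁻¹ = 0≤1/ k

      KK⁻¹≡1 : K * K⁻¹ ≡ 1ℚ
      KK⁻¹≡1 = k*1/k k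

      to : ∀ x → x ∈ map embedᶻ (ball (suc d) k) → Dilate k (EdgePolytope graph) (ι ∘ lookup x)
      to x x∈ with z , z∈ , refl ← ∈-map⁻ embedᶻ x∈ =
        embed y , polytope⁺ y ‖y‖≤1 (λ _ → refl) , λ v → begin
          ι (lookup (embedᶻ z) v)      ≡⟨ ι-embedᶻ z v ⟩
          embed (ι ∘ lookup z) v       ≡⟨ combination-congˡ b (λ j → undo (ι (lookup z j))) v ⟩
          embed (λ j → K * y j) v      ≡⟨ combination-* K y b v ⟩
          K * embed y v                ∎
        where
        open ≡-Reasoning
        y : Vector ℚ (suc d)
        y j = K⁻¹ * ι (lookup z j)
        undo : ∀ t → t ≡ K * (K⁻¹ * t)
        undo t = trans (sym (ℚₚ.*-identityˡ t)) (trans (cong (_* t) (sym KK⁻¹≡1)) (ℚₚ.*-assoc K K⁻¹ t))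
        ‖y‖≤1 : ‖ y ‖ ≤ 1ℚ
        ‖y‖≤1 = subst₂ _≤_
          (sym (trans (‖‖-* K⁻¹ (ι ∘ lookup z) 0≤K⁻¹) (cong (K⁻¹ *_) (‖ι‖ z))))
          (trans (ℚₚ.*-comm K⁻¹ K) KK⁻¹≡1)
          (ℚₚ.*-monoˡ-≤-nonNeg K⁻¹ {{ℚ.nonNegative 0≤K⁻¹}} (ι-mono-≤ (ℓ¹ z) k (ball⁻ (suc d) z∈)))

      from : ∀ x → Dilate k (EdgePolytope graph) (ι ∘ lookup x) → x ∈ map embedᶻ (ball (suc d) k)
      from x (w , w∈ , x≗) with y , ‖y‖≤1 , w≗ ← polytope⁻ w∈ =
        subst (_∈ map embedᶻ (ball (suc d) k)) (sym x≡) (∈-map⁺ embedᶻ (ball⁺ (suc d) {y = z} z≤k))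
        where
        -- A priori the preimage `K * y` of `x` is only rational. Being recovered from the integral
        -- `x` by integral functionals, it is the integral vector `z`.
        z = coordinatesᶻ x
        x≗embed : ι ∘ lookup x ≗ embed (λ j → K * y j)
        x≗embed v = trans (x≗ v) (trans (cong (K *_) (w≗ v)) (sym (combination-* K y b v)))
        z≗ : ∀ j → ι (lookup z j) ≡ K * y j
        z≗ j = trans (ι-coordinatesᶻ x j)
          (trans (combination-congˡ (λ v → ι ∘ φᵀ v) x≗embed j) (coordinates-embed (λ j → K * y j) j))
        x≡ : x ≡ embedᶻ z
        x≡ = ι-lookup-injective λ v →
          trans (x≗embed v) (trans (combination-congˡ b (sym ∘ z≗) v) (sym (ι-embedᶻ z v)))
        0≤K : 0ℚ ≤ K
        0≤K = ι-mono-≤ 0 k z≤n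
        z≤k : ℓ¹ z ℕ.≤ k
        z≤k = ι-cancel-≤ (ℓ¹ z) k (subst₂ _≤_
          (trans (sym (‖‖-* K y 0≤K)) (trans (sym (‖‖-cong z≗)) (‖ι‖ z)))
          (ℚₚ.*-identityʳ K)
          (ℚₚ.*-monoˡ-≤-nonNeg K {{ℚ.nonNegative 0≤K}} ‖y‖≤1))

    volume : HasVolume (EdgePolytope graph) (ι (+ (2 ^ suc d)))
    volume = suc d , dimension , ∣ball∣ (suc d) , latticeCount , limit
      where
      limit : HasLimit (λ k → _/_ (+ (suc d ! ℕ.* ∣ball∣ (suc d) k)) (k ^ suc d) {{ℕₚ.m^n≢0 k (suc d)}})
                     (ι (+ (2 ^ suc d)))
      limit ε 0<ε with K , small ← C/k-small (errorBound (suc d)) ε 0<ε =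
        K , λ k K≤k → ℚₚ.≤-<-trans
          (∣a/D-V∣≤C/k (suc d ! ℕ.* ∣ball∣ (suc d) k) (2 ^ suc d) (errorBound (suc d))
            (k ^ suc d) k {{ℕₚ.m^n≢0 k (suc d)}}
            (∣ball∣-upper (suc d) k) (∣ball∣-lower (suc d) k))
          (small k K≤k)

-- Distances

open import Data.Nat using (_≤_; _<_; ∣_-_∣)
open Polytope

module _ {G : Digraph} where
  open Digraph G

  snoc : ∀ {l u v w} → Walk G l u v → Arc v w → Walk G (suc l) u w
  snoc []       a = a ∷ []
  snoc (a′ ∷ p) a = a′ ∷ snoc p a

  -- A potential changing by at most 1 along each arc certifies lower bounds for distances; on the
  -- path it is the position `toℕ`.
  walk-Lipschitz : (f : Fin order → ℕ) → (∀ {u v} → Arc u v → ∣ f u - f v ∣ ≤ 1) →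
                   ∀ {l u v} → Walk G l u v → ∣ f u - f v ∣ ≤ l
  walk-Lipschitz f f-arc ([] {u}) = ℕₚ.≤-reflexive (ℕₚ.∣n-n∣≡0 (f u))
  walk-Lipschitz f f-arc (_∷_ {u = u} {v} {w} a p) = ℕₚ.≤-trans (ℕₚ.∣-∣-triangle (f u) (f v) (f w))
    (ℕₚ.+-mono-≤ (f-arc a) (walk-Lipschitz f f-arc p))

∣suc-_∣ : ∀ m → ∣ m - suc m ∣ ≡ 1
∣suc- zero ∣  = refl
∣suc- suc m ∣ = ∣suc- m ∣

-- The bidirected path

module Path (d : ℕ) where

  -- φ k is the indicator of the vertices beyond the k-th edge, the only edge at
  -- which it jumps.
  φ : ∀ {d} → Fin d → Vector ℤ (suc d)
  φ k       zero    = 0ℤ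
  φ zero    (suc v) = 1ℤ
  φ (suc k) (suc v) = φ k v

  φ-dual : ∀ {d} (j k : Fin d) → φ k (suc j) ℤ.- φ k (inject₁ j) ≡ eᶻ j k
  φ-dual zero    zero          = refl
  φ-dual zero    (suc zero)    = refl
  φ-dual zero    (suc (suc k)) = refl
  φ-dual (suc j) zero          = refl
  φ-dual (suc j) (suc k)       = φ-dual j k

  open Bidirected {d} suc inject₁ φ φ-dual public
  open Digraph graph

  Arc-toℕ : ∀ {u v} → Arc u v → ∣ toℕ u - toℕ v ∣ ≤ 1
  Arc-toℕ (j , inj₁ (refl , refl)) rewrite toℕ-inject₁ j = ℕₚ.≤-reflexive ∣suc- toℕ j ∣
  Arc-toℕ (j , inj₂ (refl , refl)) rewrite toℕ-inject₁ j =
    ℕₚ.≤-reflexive (trans (ℕₚ.∣-∣-comm (suc (toℕ j)) (toℕ j)) ∣suc- toℕ j ∣)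

  -- The recursion is on the larger end, whose form `suc j` exposes its edge `j` towards the smaller
  -- one. Here that edge comes last in the walk, hence `snoc`; in `descend` it comes first.
  ascend : ∀ l {u v} → toℕ v ≡ l ℕ.+ toℕ u → Walk graph l u v
  ascend zero eq rewrite toℕ-injective eq = []
  ascend (suc l) {v = suc j} eq =
    snoc (ascend l (trans (toℕ-inject₁ j) (ℕₚ.suc-injective eq))) (j , inj₁ (refl , refl))

  descend : ∀ l {u v} → toℕ u ≡ l ℕ.+ toℕ v → Walk graph l u v
  descend zero eq rewrite toℕ-injective eq = []
  descend (suc l) {u = suc j} eq =
    (j , inj₂ (refl , refl)) ∷ descend l (trans (toℕ-inject₁ j) (ℕₚ.suc-injective eq))

  isDistance : ∀ u v → IsDistance graph u v ∣ toℕ u - toℕ v ∣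
  isDistance u v = walk , λ l → walk-Lipschitz toℕ Arc-toℕ
    where
    walk : Walk graph ∣ toℕ u - toℕ v ∣ u v
    walk with ℕₚ.≤-total (toℕ u) (toℕ v)
    ... | inj₁ u≤v rewrite ℕₚ.m≤n⇒∣m-n∣≡n∸m u≤v = ascend (toℕ v ∸ toℕ u) (sym (ℕₚ.m∸n+n≡m u≤v))
    ... | inj₂ v≤u rewrite ℕₚ.m≤n⇒∣n-m∣≡n∸m v≤u = descend (toℕ u ∸ toℕ v) (sym (ℕₚ.m∸n+n≡m v≤u))

  hasDiameter : HasDiameter graph (suc d)
  hasDiameter =
    (λ u v → ∣ toℕ u - toℕ v ∣ , isDistance u v ,
      ℕₚ.≤-trans (ℕₚ.∣m-n∣≤m⊔n (toℕ u) (toℕ v)) (ℕₚ.⊔-lub (toℕ≤pred[n] u) (toℕ≤pred[n] v))) ,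
    zero , fromℕ (suc d) ,
    subst (IsDistance graph zero (fromℕ (suc d))) (toℕ-fromℕ (suc d)) (isDistance zero (fromℕ (suc d)))

-- The bidirected star

-- d + 2 leaves, so that the diameter is attained.
module Star (d : ℕ) where

  -- The dual functionals are the coordinates at the leaves; they vanish at the centre `zero`, the
  -- common tail of the chosen arcs.
  open Bidirected {suc d} suc (λ _ → zero) (λ k v → eᶻ v (suc k)) (λ j k → ℤₚ.+-identityʳ (eᶻ j k)) public
  open Digraph graph

  in-arc : ∀ j → Arc (suc j) zero
  in-arc j = j , inj₂ (refl , refl)

  out-arc : ∀ j → Arc zero (suc j)
  out-arc j = j , inj₁ (refl , refl)

  1≤length : ∀ {u v} → u ≢ v → ∀ l → Walk graph l u v → 1 ≤ l
  1≤length u≢v zero    [] = contradiction refl u≢v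
  1≤length u≢v (suc l) p  = s≤s z≤n

  -- Every arc has the centre as one of its ends, so a single arc never joins two leaves.
  2≤length : ∀ {j k} → j ≢ k → ∀ l → Walk graph l (suc j) (suc k) → 2 ≤ l
  2≤length j≢k zero          []                                  = contradiction refl j≢k
  2≤length j≢k (suc zero)    ((_ , inj₁ (() , _)) ∷ [])
  2≤length j≢k (suc zero)    ((_ , inj₂ (_ , ())) ∷ [])
  2≤length j≢k (suc (suc l)) p                                   = s≤s (s≤s z≤n)

  leaf-distance : ∀ {j k} → j ≢ k → IsDistance graph (suc j) (suc k) 2
  leaf-distance {j} {k} j≢k = in-arc j ∷ (out-arc k ∷ []) , 2≤length j≢k

  distance : ∀ u v → ∃[ l ] IsDistance graph u v l × l ≤ 2
  distance zero    zero    = 0 , ([] , λ _ _ → z≤n) , z≤n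
  distance zero    (suc k) = 1 , (out-arc k ∷ [] , 1≤length λ ()) , s≤s z≤n
  distance (suc j) zero    = 1 , (in-arc j ∷ [] , 1≤length λ ()) , s≤s z≤n
  distance (suc j) (suc k) with j ≟ k
  ... | yes refl = 0 , ([] , λ _ _ → z≤n) , z≤n
  ... | no  j≢k  = 2 , leaf-distance j≢k , ℕₚ.≤-refl

  hasDiameter : HasDiameter graph 2
  hasDiameter = distance , suc zero , suc (suc zero) , leaf-distance λ ()

theorem9 : (i : ℕ) → 8 ≤ i →
    ∃[ j ] j < i ×
    (Σ[ G ∈ Digraph ] Σ[ H ∈ Digraph ]
    HasDiameter G i × HasDiameter H j ×
    (Σ[ q ∈ ℚ ] HasVolume (EdgePolytope G) q × HasVolume (EdgePolytope H) q))
theorem9 (suc zero) (s≤s ())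
theorem9 i@(suc (suc d)) 8≤i =
  2 , ℕₚ.≤-trans (ℕₚ.m≤n+m 3 5) 8≤i ,
  -- Both trees have `i` edges: the parameter of `Path` is the number of edges less one, that of
  -- `Star` the number of leaves less two.
  Path.graph (suc d) , Star.graph d ,
  Path.hasDiameter (suc d) , Star.hasDiameter d ,
  ι (+ (2 ^ i)) , Path.volume (suc d) , Star.volume d
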